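{- There are positive constants $c$ and $d$ such that for every finite group $G$ and any normal subgroup $N$ of $G$, if $G/N$ is cyclic and $N$ has an $(s,t)$-data structure for some $s$ and $t$, then $G$ has an $(s+c|G|,\,2t+d)$-data structure.
   Context: Model of computation (word-RAM): data is stored in registers and memory units, each of which holds one word of $O(\log n)$ bits, where $n$ is the input size. Here the input size is the order of the group given as input. The machine can access a word and perform the usual arithmetic, logical and comparison operations on words in constant time. The elements of a group of order $n$ are taken to be $1,2,\ldots,n$, so each element fits in one word and can be accessed in constant time. Data structures have two phases. In the preprocessing phase the finite group is given by its Cayley table, and a data structure consisting of some arrays and tables is built from it. In the query phase a multiplication query consists of two group elements $g_1,g_2$ supplied by the user, and the task is to return the product $g_1g_2$ using the data structure. The time taken to answer a single query is the query-time. The space is the number of words used by the data structure. Time and space used in preprocessing are not counted. For a group $G$ and positive real numbers $s,t$, we say that $G$ has an $(s,t)$-data structure if $G$ can be stored in a data structure that uses at most $s$ space and can answer a multiplication query in time at most $t$. -}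

module Defs where

open import Algebra.Bundles using (Group)
open import Algebra.Structures using (IsGroup)
open import Algebra.Morphism.Structures using (module GroupMorphisms)
import Algebra.Definitions.RawMonoid as RawMonoidDefinitions
import Algebra.Properties.Group as GroupProperties
open import Data.Bool.Base using (Bool; if_then_else_; _∧_; _∨_; _xor_)
open import Data.Fin.Base using (Fin; toℕ)
open import Data.Integer.Base using (ℤ; +_; -[1+_])
open import Data.List.Base using (List; length; map; head; drop)
open import Data.List.Relation.Unary.All using (All)
open import Data.Maybe.Base using (Maybe; just; nothing)
open import Data.Nat.Base
  using (ℕ; zero; suc; _+_; _*_; _∸_; _^_; _≤_; _<_; _≡ᵇ_; _<ᵇ_; _≤ᵇ_)
open import Data.Nat.DivMod using (_/_; _%_)
open import Data.Nat.ListAction using (sum)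
open import Data.Nat.Logarithm using (⌊log₂_⌋)
open import Data.Nat.Properties using (m^n≢0)
open import Data.Product.Base using (∃; ∃-syntax; _×_; _,_)
open import Level using (Level; _⊔_; 0ℓ)
open import Relation.Binary.PropositionalEquality
  using (_≡_; refl; sym; trans; cong; cong₂; module ≡-Reasoning)

private
  variable
    a ℓ : Level
    A : Set a
    n : ℕ

-- The elements are numbered by Fin n, and _∙_ is the Cayley table.

record FiniteGroup (n : ℕ) : Set where
  infixl 7 _∙_
  infix  8 _⁻¹
  field
    _∙_     : Fin n → Fin n → Fin n
    ε       : Fin n
    _⁻¹     : Fin n → Fin n
    isGroup : IsGroup _≡_ _∙_ ε _⁻¹

  group : Group 0ℓ 0ℓ
  group = record { isGroup = isGroup }

-- N is a subset of G, namely the image of ι.  Being a group in its own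
-- right, it also has its own Cayley table; ι records which element of G
-- each number of that table stands for, and the numbering is arbitrary.

record NormalSubgroup (G : FiniteGroup n) : Set where
  open FiniteGroup G using (_∙_; _⁻¹; group)
  field
    order    : ℕ
    subgroup : FiniteGroup order
    ι        : Fin order → Fin n

  open GroupMorphisms (Group.rawGroup (FiniteGroup.group subgroup)) (Group.rawGroup group)

  field
    isGroupMonomorphism : IsGroupMonomorphism ι
    normal              : ∀ g h → ∃[ k ] ι k ≡ g ∙ ι h ∙ g ⁻¹

  open IsGroupMonomorphism isGroupMonomorphism public

-- The quotient is the setoid of elements of G, with x ≈ y when xN = yN.

module _ (G : FiniteGroup n) (N : NormalSubgroup G) where
  open Group (FiniteGroup.group G)
    using (_∙_; ε; _⁻¹; _\\_; assoc; identityˡ; identityʳ; inverseˡ; inverseʳ)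
  open GroupProperties (FiniteGroup.group G)
  open NormalSubgroup N using (ι; subgroup; normal; ε-homo; ∙-homo; ⁻¹-homo)
  private
    module N = FiniteGroup subgroup
    open ≡-Reasoning

  SameCoset : Fin n → Fin n → Set
  SameCoset x y = ∃[ h ] ι h ≡ x \\ y

  private
    reflexive′ : ∀ {x y} → x ≡ y → SameCoset x y
    reflexive′ {x} refl = N.ε , trans ε-homo (sym (inverseˡ x))

    sym′ : ∀ {x y} → SameCoset x y → SameCoset y x
    sym′ {x} {y} (h , eq) = h N.⁻¹ , (begin
      ι (h N.⁻¹)   ≡⟨ ⁻¹-homo h ⟩
      ι h ⁻¹       ≡⟨ cong _⁻¹ eq ⟩
      (x \\ y) ⁻¹  ≡⟨ ⁻¹-anti-homo-\\ x y ⟩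
      y \\ x       ∎)

    trans′ : ∀ {x y z} → SameCoset x y → SameCoset y z → SameCoset x z
    trans′ {x} {y} {z} (h , p) (k , q) = h N.∙ k , (begin
      ι (h N.∙ k)            ≡⟨ ∙-homo h k ⟩
      ι h ∙ ι k              ≡⟨ cong₂ _∙_ p q ⟩
      (x ⁻¹ ∙ y) ∙ (y \\ z)  ≡⟨ assoc (x ⁻¹) y (y \\ z) ⟩
      x ⁻¹ ∙ (y ∙ (y \\ z))  ≡⟨ cong (x ⁻¹ ∙_) (\\-leftDividesˡ y z) ⟩
      x \\ z                 ∎)

    ∙-cong′ : ∀ {x y u v} → SameCoset x y → SameCoset u v → SameCoset (x ∙ u) (y ∙ v)
    ∙-cong′ {x} {y} {u} {v} (h , p) (k , q) with normal (u ⁻¹) h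
    ... | h′ , r = h′ N.∙ k , (begin
      ι (h′ N.∙ k)                                 ≡⟨ ∙-homo h′ k ⟩
      ι h′ ∙ ι k                                   ≡⟨ cong₂ _∙_ r q ⟩
      (u ⁻¹ ∙ ι h ∙ u ⁻¹ ⁻¹) ∙ (u \\ v)            ≡⟨ cong (λ z → (u ⁻¹ ∙ ι h ∙ z) ∙ (u \\ v)) (⁻¹-involutive u) ⟩
      (u ⁻¹ ∙ ι h ∙ u) ∙ (u \\ v)                  ≡⟨ assoc (u ⁻¹ ∙ ι h) u (u \\ v) ⟩
      (u ⁻¹ ∙ ι h) ∙ (u ∙ (u \\ v))                ≡⟨ cong ((u ⁻¹ ∙ ι h) ∙_) (\\-leftDividesˡ u v) ⟩
      (u ⁻¹ ∙ ι h) ∙ v                             ≡⟨ cong (λ z → (u ⁻¹ ∙ z) ∙ v) p ⟩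
      (u ⁻¹ ∙ (x ⁻¹ ∙ y)) ∙ v                      ≡⟨ cong (_∙ v) (assoc (u ⁻¹) (x ⁻¹) y) ⟨
      ((u ⁻¹ ∙ x ⁻¹) ∙ y) ∙ v                      ≡⟨ cong (λ z → (z ∙ y) ∙ v) (⁻¹-anti-homo-∙ x u) ⟨
      ((x ∙ u) ⁻¹ ∙ y) ∙ v                         ≡⟨ assoc ((x ∙ u) ⁻¹) y v ⟩
      (x ∙ u) \\ (y ∙ v)                           ∎)

    ⁻¹-cong′ : ∀ {x y} → SameCoset x y → SameCoset (x ⁻¹) (y ⁻¹)
    ⁻¹-cong′ {x} {y} x~y with sym′ x~y
    ... | h , p with normal x h
    ...   | h′ , r = h′ , (begin
      ι h′                     ≡⟨ r ⟩
      x ∙ ι h ∙ x ⁻¹           ≡⟨ cong (λ z → x ∙ z ∙ x ⁻¹) p ⟩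
      x ∙ (y ⁻¹ ∙ x) ∙ x ⁻¹    ≡⟨ assoc x (y ⁻¹ ∙ x) (x ⁻¹) ⟩
      x ∙ ((y ⁻¹ ∙ x) ∙ x ⁻¹)  ≡⟨ cong (x ∙_) (//-rightDividesʳ x (y ⁻¹)) ⟩
      x ∙ y ⁻¹                 ≡⟨ cong (_∙ y ⁻¹) (⁻¹-involutive x) ⟨
      x ⁻¹ \\ y ⁻¹             ∎)

  quotient : Group 0ℓ 0ℓ
  quotient = record
    { _≈_     = SameCoset
    ; _∙_     = _∙_
    ; ε       = ε
    ; _⁻¹     = _⁻¹
    ; isGroup = record
      { isMonoid = record
        { isSemigroup = record
          { isMagma = record
            { isEquivalence = record
              { refl  = reflexive′ refl
              ; sym   = sym′
              ; trans = trans′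
              }
            ; ∙-cong = ∙-cong′
            }
          ; assoc = λ x y z → reflexive′ (assoc x y z)
          }
        ; identity = (λ x → reflexive′ (identityˡ x)) , (λ x → reflexive′ (identityʳ x))
        }
      ; inverse = (λ x → reflexive′ (inverseˡ x)) , (λ x → reflexive′ (inverseʳ x))
      ; ⁻¹-cong = ⁻¹-cong′
      }
    }

module _ (G : Group a ℓ) where
  open Group G using (Carrier; _≈_; _⁻¹; rawMonoid)
  open RawMonoidDefinitions rawMonoid using () renaming (_×_ to _times_)

  power : Carrier → ℤ → Carrier
  power g (+ k)    = k times g
  power g -[1+ k ] = (suc k times g) ⁻¹

  IsCyclic : Set (a ⊔ ℓ)
  IsCyclic = ∃[ g ] ∀ x → ∃[ k ] x ≈ power g k

-- κ is the constant hidden in "words of O(log n) bits"; 1 + ⌊log₂ n ⌋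
-- is the length of the binary representation of n.

wordLength : (κ n : ℕ) → ℕ
wordLength κ n = κ * (1 + ⌊log₂ n ⌋)

Word : (w : ℕ) → ℕ → Set
Word w v = v < 2 ^ w

data Op : Set where
  add sub mul div mod and or xor shl shr : Op

data Comparison : Set where
  eq lt le : Comparison

Register ArrayName Label : Set
Register  = ℕ
ArrayName = ℕ
Label     = ℕ

data Instruction : Set where
  literal : (r : Register) (v : ℕ)                      → Instruction  -- r := v
  copy    : (r r₁ : Register)                           → Instruction  -- r := r₁
  compute : (op : Op) (r r₁ r₂ : Register)              → Instruction  -- r := r₁ op r₂
  read    : (r : Register) (A : ArrayName) (r₁ : Register) → Instruction  -- r := A[r₁]
  load    : (r r₁ : Register)                           → Instruction  -- r := scratch[r₁]
  store   : (r₁ r₂ : Register)                          → Instruction  -- scratch[r₁] := r₂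
  branch  : (c : Comparison) (r₁ r₂ : Register) (l : Label) → Instruction  -- if r₁ c r₂ then goto l
  jump    : (l : Label)                                 → Instruction
  halt    : Instruction

-- The first argument bounds the number of binary digits to process;
-- i + j is enough since i < 2 ^ i.

bitwise : (Bool → Bool → Bool) → ℕ → ℕ → ℕ
bitwise f i j = go (i + j) i j
  where
  go : ℕ → ℕ → ℕ → ℕ
  go zero    _ _ = 0
  go (suc k) i j =
    (if f (i % 2 ≡ᵇ 1) (j % 2 ≡ᵇ 1) then 1 else 0) + 2 * go k (i / 2) (j / 2)

-- Exact arithmetic on ℕ: an instruction whose result does not fit in a
-- word cannot be executed (see _⟶_), rather than wrapping around.
-- Subtraction is truncated at zero, and division by zero is an error.

evalOp : Op → ℕ → ℕ → Maybe ℕ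
evalOp add i j       = just (i + j)
evalOp sub i j       = just (i ∸ j)
evalOp mul i j       = just (i * j)
evalOp div i zero    = nothing
evalOp div i (suc j) = just (i / suc j)
evalOp mod i zero    = nothing
evalOp mod i (suc j) = just (i % suc j)
evalOp and i j       = just (bitwise _∧_ i j)
evalOp or  i j       = just (bitwise _∨_ i j)
evalOp xor i j       = just (bitwise _xor_ i j)
evalOp shl i j       = just (i * 2 ^ j)
evalOp shr i j       = just ((i / 2 ^ j) {{m^n≢0 2 j}})

evalComparison : Comparison → ℕ → ℕ → Bool
evalComparison eq = _≡ᵇ_
evalComparison lt = _<ᵇ_
evalComparison le = _≤ᵇ_

infix 9 _at_

_at_ : List A → ℕ → Maybe A
xs at i = head (drop i xs)

-- Cells that have not been written yet hold nothing; reading one of them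
-- is an error, so no information can be hidden in the initial state.

Cells : Set
Cells = ℕ → Maybe ℕ

infixl 9 _[_↦_]

_[_↦_] : Cells → ℕ → ℕ → Cells
(m [ i ↦ v ]) j = if i ≡ᵇ j then just v else m j

record State : Set where
  constructor ⟨_,_,_⟩
  field
    counter   : Label
    registers : Cells
    scratch   : Cells

-- The arrays are those built during preprocessing; a query reads them
-- but does not modify them, so that they can serve any number of queries.

module Execution (w : ℕ) (arrays : List (List ℕ)) (code : List Instruction) where

  infix 4 _⟶_

  data _⟶_ : State → State → Set where

    literal : ∀ {p ρ μ r v} →
      code at p ≡ just (literal r v) → Word w v →
      ⟨ p , ρ , μ ⟩ ⟶ ⟨ suc p , ρ [ r ↦ v ] , μ ⟩

    copy : ∀ {p ρ μ r r₁ v} →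
      code at p ≡ just (copy r r₁) → ρ r₁ ≡ just v →
      ⟨ p , ρ , μ ⟩ ⟶ ⟨ suc p , ρ [ r ↦ v ] , μ ⟩

    compute : ∀ {p ρ μ op r r₁ r₂ v₁ v₂ v} →
      code at p ≡ just (compute op r r₁ r₂) →
      ρ r₁ ≡ just v₁ → ρ r₂ ≡ just v₂ → evalOp op v₁ v₂ ≡ just v → Word w v →
      ⟨ p , ρ , μ ⟩ ⟶ ⟨ suc p , ρ [ r ↦ v ] , μ ⟩

    read : ∀ {p ρ μ r A r₁ xs i v} →
      code at p ≡ just (read r A r₁) →
      arrays at A ≡ just xs → ρ r₁ ≡ just i → xs at i ≡ just v →
      ⟨ p , ρ , μ ⟩ ⟶ ⟨ suc p , ρ [ r ↦ v ] , μ ⟩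

    load : ∀ {p ρ μ r r₁ i v} →
      code at p ≡ just (load r r₁) → ρ r₁ ≡ just i → μ i ≡ just v →
      ⟨ p , ρ , μ ⟩ ⟶ ⟨ suc p , ρ [ r ↦ v ] , μ ⟩

    store : ∀ {p ρ μ r₁ r₂ i v} →
      code at p ≡ just (store r₁ r₂) → ρ r₁ ≡ just i → ρ r₂ ≡ just v →
      ⟨ p , ρ , μ ⟩ ⟶ ⟨ suc p , ρ , μ [ i ↦ v ] ⟩

    branch : ∀ {p ρ μ c r₁ r₂ l v₁ v₂} →
      code at p ≡ just (branch c r₁ r₂ l) → ρ r₁ ≡ just v₁ → ρ r₂ ≡ just v₂ →
      ⟨ p , ρ , μ ⟩ ⟶ ⟨ (if evalComparison c v₁ v₂ then l else suc p) , ρ , μ ⟩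

    jump : ∀ {p ρ μ l} →
      code at p ≡ just (jump l) →
      ⟨ p , ρ , μ ⟩ ⟶ ⟨ l , ρ , μ ⟩

  -- Outputs t σ v: started in σ, the machine halts after exactly t
  -- instructions (including the final halt) with v in register 0.

  data Outputs : ℕ → State → ℕ → Set where
    stop : ∀ {p ρ μ v} →
      code at p ≡ just halt → ρ 0 ≡ just v → Outputs 1 ⟨ p , ρ , μ ⟩ v
    step : ∀ {t σ σ′ v} →
      σ ⟶ σ′ → Outputs t σ′ v → Outputs (suc t) σ v

-- The element i : Fin n is the word 1 + i, so the elements are 1, …, n.

encode : Fin n → ℕ
encode i = suc (toℕ i)

query : Fin n → Fin n → State
query x y = ⟨ 0 , (λ _ → nothing) [ 0 ↦ encode x ] [ 1 ↦ encode y ] , (λ _ → nothing) ⟩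

record DataStructure (w : ℕ) : Set where
  field
    arrays : List (List ℕ)
    words  : All (All (Word w)) arrays
    code   : List Instruction

  -- The code may depend on the group, so it is stored and charged with
  -- the arrays; otherwise a Cayley table could be hidden in it for free.
  space : ℕ
  space = sum (map length arrays) + length code

  open Execution w arrays code public

-- Space and time are natural numbers, so "at most s" and "at most t" for
-- real s and t only depend on ⌊s⌋ and ⌊t⌋.

HasDataStructure : (κ : ℕ) → FiniteGroup n → (s t : ℕ) → Set
HasDataStructure {n} κ G s t =
  ∃[ D ] let open DataStructure {wordLength κ n} D in
    space ≤ s ×
    (∀ x y → ∃[ t′ ] t′ ≤ t × Outputs t′ (query x y) (encode (x ∙ y)))
  where open FiniteGroup G using (_∙_)

-- Let gN generate G/N and let m be the order of G/N, so that every element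
-- of G is gⁱ a for unique i < m and a ∈ N.  Then
--   (gⁱ a)(gʲ b) = gⁱ⁺ʲ ((g⁻ʲ a gʲ) b),
-- and if i + j ≥ m then the surplus gᵐ ∈ N is moved into the factor
-- g⁻ʲ a gʲ.  Either version of this factor depends only on j and a, so it is
-- tabulated in |G| words, and one query to the data structure of N suffices.
-- Its program is inlined once: halt becomes a jump, and a register that the
-- program does not write keeps the power of g meanwhile.

module Submission where

open import Defs
open import Algebra.Bundles using (Group)
import Algebra.Properties.Group as GroupProperties
import Algebra.Properties.Monoid.Mult as Mult
open import Data.Bool.Base using (T; true; false; if_then_else_)
open import Data.Bool.Properties using (if-float; T-≡)
open import Data.Fin.Base using (Fin; zero; suc; toℕ; fromℕ<; combine; remQuot)
open import Data.Fin.Properties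
  using (toℕ<n; toℕ-fromℕ<; toℕ-injective; toℕ-combine; remQuot-combine; combine-remQuot; injective⇒≤; nonZeroIndex; pigeonhole; any?; _≟_)
import Data.Integer.Base as ℤ
open import Data.List.Base using (List; []; _∷_; _++_; length; map; tabulate)
open import Data.List.Extrema.Nat using (max; xs≤max)
open import Data.List.Properties using (length-map; length-++; length-tabulate; map-++)
open import Data.List.Relation.Unary.All as All using (All; []; _∷_)
import Data.List.Relation.Unary.All.Properties as All
open import Data.Maybe.Base using (just; nothing)
open import Data.Nat.Base
  using (ℕ; zero; suc; NonZero; _+_; _*_; _∸_; _^_; _≤_; _<_; _≡ᵇ_; _<ᵇ_; z≤n; s≤s; z<s; s<s⁻¹)
open import Data.Nat.ListAction using (sum)
open import Data.Nat.ListAction.Properties using (sum-++)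
open import Data.Nat.Logarithm using (⌊log₂_⌋; ⌊log₂⌋-mono-≤; ⌊log₂[2^n]⌋≡n)
open import Data.Nat.Properties hiding (_≟_)
open import Data.Nat.Solver using (module +-*-Solver)
open import Data.Product.Base using (∃₂; ∃-syntax; _×_; _,_; proj₁; proj₂; uncurry)
open import Data.Sum.Base using (inj₁; inj₂)
open import Function.Base using (_∘_)
open import Function.Bundles using (Equivalence)
open import Level using (Level)
open import Relation.Binary.PropositionalEquality
open import Relation.Nullary using (¬_; yes; no; contradiction)
open import Relation.Unary using (Pred; Decidable)

private
  variable
    c ℓ p : Level
    A B : Set c
    l m n q v : ℕ

-- Least witnesses, and powers of an element of finite order.

least : {P : Pred ℕ p} → Decidable P → ∀ k → P k → ∃[ m ] P m × ∀ j → j < m → ¬ P j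
least P? zero    pk = zero , pk , λ _ ()
least P? (suc k) pk with P? zero
... | yes p₀ = zero , p₀ , λ _ ()
... | no ¬p₀ with least (λ j → P? (suc j)) k pk
...   | m , pm , min = suc m , pm , λ where
  zero    _   → ¬p₀
  (suc j) j<m → min j (s<s⁻¹ j<m)

module _ (G : Group c ℓ) where
  open Group G using (Carrier; _≈_; ε; monoid; ∙-congˡ; ⁻¹-cong)
    renaming (refl to ≈-refl; sym to ≈-sym; trans to ≈-trans; reflexive to ≈-reflexive)
  open GroupProperties G using (inverseʳ-unique; identityʳ-unique)
  open Mult monoid using (×-homo-+) renaming (_×_ to infixr 8 _times_)

  times-cancel : ∀ g {i j} → i ≤ j → i times g ≈ j times g → (j ∸ i) times g ≈ ε
  times-cancel g {i} {j} i≤j eqn = identityʳ-unique (i times g) _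
    (≈-trans (≈-sym (×-homo-+ g i (j ∸ i))) (≈-trans (≈-reflexive (cong (_times g) (m+[n∸m]≡n i≤j))) (≈-sym eqn)))

  module _ (g : Carrier) {m : ℕ} (0<m : 0 < m) (gᵐ≈ε : m times g ≈ ε) where

    times-reduce : ∀ k → ∃[ i ] i < m × k times g ≈ i times g
    times-reduce zero    = 0 , 0<m , ≈-refl
    times-reduce (suc k) with times-reduce k
    ... | i , i<m , eqn with m≤n⇒m<n∨m≡n i<m
    ...   | inj₁ 1+i<m = suc i , 1+i<m , ∙-congˡ eqn
    ...   | inj₂ refl  = 0 , 0<m , ≈-trans (∙-congˡ eqn) gᵐ≈ε

    power-reduce : ∀ z → ∃[ i ] i < m × power G g z ≈ i times g
    power-reduce (ℤ.+ k)    = times-reduce k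
    power-reduce ℤ.-[1+ k ] with times-reduce (suc k)
    -- The inverse of gⁱ is gᵐ⁻ⁱ; for i = 0 this exponent is m itself, so it is reduced once more.
    ... | i , i<m , eqn with times-reduce (m ∸ i)
    ...   | j , j<m , eqn′ = j , j<m , ≈-trans (⁻¹-cong eqn) (≈-trans (≈-sym (inverseʳ-unique (i times g) _
      (≈-trans (≈-sym (×-homo-+ g i (m ∸ i))) (≈-trans (≈-reflexive (cong (_times g) (m+[n∸m]≡n (<⇒≤ i<m)))) gᵐ≈ε)))) eqn′)

-- Coordinates on an extension with cyclic quotient.

-- join i a stands for gⁱ a, twist j a for g⁻ʲ a gʲ and carryTwist j a for
-- gᵐ g⁻ʲ a gʲ, where m = index.

record Coordinates (G : FiniteGroup n) (H : FiniteGroup q) : Set where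
  private
    module G = FiniteGroup G
    module H = FiniteGroup H
  field
    index          : ℕ
    join           : Fin index → Fin q → Fin n
    join-injective : ∀ {i j a b} → join i a ≡ join j b → i ≡ j × a ≡ b
    row            : Fin n → Fin index
    entry          : Fin n → Fin q
    twist          : Fin index → Fin q → Fin q
    carryTwist     : Fin index → Fin q → Fin q
    ∙-join         : ∀ x y k → toℕ (row x) + toℕ (row y) ≡ toℕ k →
                     join k (twist (row y) (entry x) H.∙ entry y) ≡ x G.∙ y
    ∙-join-carry   : ∀ x y k → toℕ (row x) + toℕ (row y) ≡ toℕ k + index →
                     join k (carryTwist (row y) (entry x) H.∙ entry y) ≡ x G.∙ y

module _ (G : FiniteGroup n) (N : NormalSubgroup G) where
  open Group (FiniteGroup.group G)
    using (_∙_; ε; _⁻¹; _\\_; assoc; identityˡ; monoid)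
  open GroupProperties (FiniteGroup.group G)
  open NormalSubgroup N using (order; subgroup; ι; normal; ∙-homo; injective)
  open Mult monoid using (×-homo-+) renaming (_×_ to infixr 8 _times_)
  private
    module N = FiniteGroup subgroup
    module Q = Group (quotient G N)
    module Q× = Mult Q.monoid
  open ≡-Reasoning

  -- The quotient keeps the carrier and the operation of G, so the powers agree as elements of G and
  -- not only up to cosets.
  times-quotient : ∀ k x → k Q×.× x ≡ k times x
  times-quotient zero    x = refl
  times-quotient (suc k) x = cong (x ∙_) (times-quotient k x)

  -- Moving a past v conjugates it by v⁻¹. The double inverse is the shape in which `normal (v ⁻¹)`
  -- delivers the conjugate.
  twisted-product : ∀ u a v b → (u ∙ v) ∙ ((v ⁻¹ ∙ a ∙ v ⁻¹ ⁻¹) ∙ b) ≡ (u ∙ a) ∙ (v ∙ b)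
  twisted-product u a v b = begin
    (u ∙ v) ∙ ((v ⁻¹ ∙ a ∙ v ⁻¹ ⁻¹) ∙ b)  ≡⟨ cong (λ z → (u ∙ v) ∙ ((v ⁻¹ ∙ a ∙ z) ∙ b)) (⁻¹-involutive v) ⟩
    (u ∙ v) ∙ ((v ⁻¹ ∙ a ∙ v) ∙ b)        ≡⟨ cong ((u ∙ v) ∙_) (assoc (v ⁻¹ ∙ a) v b) ⟩
    (u ∙ v) ∙ ((v ⁻¹ ∙ a) ∙ (v ∙ b))      ≡⟨ assoc u v _ ⟩
    u ∙ (v ∙ ((v ⁻¹ ∙ a) ∙ (v ∙ b)))      ≡⟨ cong (λ z → u ∙ (v ∙ z)) (assoc (v ⁻¹) a (v ∙ b)) ⟩
    u ∙ (v ∙ (v \\ (a ∙ (v ∙ b))))        ≡⟨ cong (u ∙_) (\\-leftDividesˡ v _) ⟩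
    u ∙ (a ∙ (v ∙ b))                     ≡⟨ assoc u a _ ⟨
    (u ∙ a) ∙ (v ∙ b)                     ∎

  -- The last two hypotheses say that `suc m-1` is the order of gN; the successors exclude the
  -- trivial zeroth power.
  coordinatesOfGenerator :
    ∀ g → (∀ x → ∃[ k ] x Q.≈ power (quotient G N) g k) →
    ∀ m-1 → suc m-1 Q×.× g Q.≈ ε → (∀ j → j < m-1 → ¬ (suc j Q×.× g Q.≈ ε)) →
    Coordinates G subgroup
  coordinatesOfGenerator g generates m-1 gᵐ≈ε minimal = record
    { index          = index
    ; join           = join
    ; join-injective = join-injective
    ; row            = row
    ; entry          = entry
    ; twist          = twist
    ; carryTwist     = λ j a → carry N.∙ twist j a
    ; ∙-join         = ∙-join
    ; ∙-join-carry   = ∙-join-carry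
    }
    where
    index : ℕ
    index = suc m-1

    join : Fin index → Fin order → Fin n
    join i a = toℕ i times g ∙ ι a

    -- Otherwise `j ∸ i` would be a positive exponent below the order of gN with trivial power,
    -- against minimality.
    coset-injective : ∀ {i j} → i ≤ j → j < index → i times g Q.≈ j times g → i ≡ j
    coset-injective {i} {j} i≤j j<m eqn with j ∸ i in eqn₁
        | times-cancel (quotient G N) g i≤j
            (Q.trans (Q.reflexive (times-quotient i g)) (Q.trans eqn (Q.reflexive (sym (times-quotient j g)))))
    ... | zero  | _ = trans (sym (+-identityʳ i)) (trans (cong (i +_) (sym eqn₁)) (m+[n∸m]≡n i≤j))
    ... | suc k | t = contradiction t
      (minimal k (s<s⁻¹ (subst (_< index) eqn₁ (≤-<-trans (m∸n≤m j i) j<m))))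

    join-coset : ∀ i a → i times g Q.≈ i times g ∙ ι a
    join-coset i a = a , sym (\\-leftDividesʳ (i times g) (ι a))

    -- The common coset fixes the exponent; then gⁱ cancels, and `ι` is injective.
    join-injective : ∀ {i j a b} → join i a ≡ join j b → i ≡ j × a ≡ b
    join-injective {i} {j} {a} {b} eqn with toℕ-injective i≡j
      where
      i≈j : toℕ i times g Q.≈ toℕ j times g
      i≈j = Q.trans (join-coset (toℕ i) a) (Q.trans (Q.reflexive eqn) (Q.sym (join-coset (toℕ j) b)))
      i≡j : toℕ i ≡ toℕ j
      i≡j with ≤-total (toℕ i) (toℕ j)
      ... | inj₁ i≤j = coset-injective i≤j (toℕ<n j) i≈j
      ... | inj₂ j≤i = sym (coset-injective j≤i (toℕ<n i) (Q.sym i≈j))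
    ... | refl = refl , injective (∙-cancelˡ (toℕ i times g) (ι a) (ι b) eqn)

    decompose : ∀ x → ∃₂ λ i a → join i a ≡ x
    decompose x with generates x
    ... | z , x≈gᶻ with power-reduce (quotient G N) g z<s gᵐ≈ε z
    -- Symmetry turns the relation in the direction whose witness a satisfies ι a = g⁻ⁱ x.
    ...   | i , i<m , gᶻ≈gⁱ with Q.sym (Q.trans x≈gᶻ (Q.trans gᶻ≈gⁱ (Q.reflexive (times-quotient i g))))
    ...     | a , eqn = fromℕ< i<m , a , (begin
      toℕ (fromℕ< i<m) times g ∙ ι a  ≡⟨ cong₂ (λ j y → j times g ∙ y) (toℕ-fromℕ< i<m) eqn ⟩
      i times g ∙ (i times g \\ x)    ≡⟨ \\-leftDividesˡ (i times g) x ⟩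
      x                               ∎)

    row : Fin n → Fin index
    row x = proj₁ (decompose x)

    entry : Fin n → Fin order
    entry x = proj₁ (proj₂ (decompose x))

    join-row-entry : ∀ x → join (row x) (entry x) ≡ x
    join-row-entry x = proj₂ (proj₂ (decompose x))

    twist : Fin index → Fin order → Fin order
    twist j a = proj₁ (normal ((toℕ j times g) ⁻¹) a)

    gᵐ∈N : ∃[ e ] ι e ≡ ε \\ index times g
    gᵐ∈N = Q.trans (Q.sym gᵐ≈ε) (Q.reflexive (times-quotient index g))

    carry : Fin order
    carry = proj₁ gᵐ∈N

    ι-carry : ι carry ≡ index times g
    ι-carry = trans (proj₂ gᵐ∈N) (trans (cong (_∙ index times g) ε⁻¹≈ε) (identityˡ _))

    -- The exponent i + j is left unreduced, so that the cases with and without carry both follow.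
    product : ∀ x y → (toℕ (row x) + toℕ (row y)) times g ∙ ι (twist (row y) (entry x) N.∙ entry y) ≡ x ∙ y
    product x y = begin
      (i + j) times g ∙ ι (twist (row y) a N.∙ b)
        ≡⟨ cong₂ _∙_ (×-homo-+ g i j) (∙-homo _ b) ⟩
      (i times g ∙ j times g) ∙ (ι (twist (row y) a) ∙ ι b)
        ≡⟨ cong (λ z → (i times g ∙ j times g) ∙ (z ∙ ι b)) (proj₂ (normal ((j times g) ⁻¹) a)) ⟩
      _ ≡⟨ twisted-product (i times g) (ι a) (j times g) (ι b) ⟩
      join (row x) a ∙ join (row y) b
        ≡⟨ cong₂ _∙_ (join-row-entry x) (join-row-entry y) ⟩
      x ∙ y ∎
      where
      i j : ℕ
      i = toℕ (row x)
      j = toℕ (row y)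
      a b : Fin order
      a = entry x
      b = entry y

    ∙-join : ∀ x y k → toℕ (row x) + toℕ (row y) ≡ toℕ k →
             join k (twist (row y) (entry x) N.∙ entry y) ≡ x ∙ y
    ∙-join x y k eqn = trans (cong (λ l → l times g ∙ ι (twist (row y) (entry x) N.∙ entry y)) (sym eqn)) (product x y)

    -- The surplus gᵐ stands directly to the right of gᵏ, so `carry` multiplies the twisted factor
    -- from the left.
    ∙-join-carry : ∀ x y k → toℕ (row x) + toℕ (row y) ≡ toℕ k + index →
                   join k (carry N.∙ twist (row y) (entry x) N.∙ entry y) ≡ x ∙ y
    ∙-join-carry x y k eqn = begin
      gᵏ ∙ ι (carry N.∙ f N.∙ b)                         ≡⟨ cong (λ z → gᵏ ∙ ι z) (Group.assoc N.group carry f b) ⟩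
      gᵏ ∙ ι (carry N.∙ (f N.∙ b))                       ≡⟨ cong (gᵏ ∙_) (∙-homo carry _) ⟩
      gᵏ ∙ (ι carry ∙ ι (f N.∙ b))                       ≡⟨ assoc gᵏ _ _ ⟨
      (gᵏ ∙ ι carry) ∙ ι (f N.∙ b)                       ≡⟨ cong (λ z → (gᵏ ∙ z) ∙ ι (f N.∙ b)) ι-carry ⟩
      (gᵏ ∙ index times g) ∙ ι (f N.∙ b)                 ≡⟨ cong (_∙ ι (f N.∙ b)) (×-homo-+ g (toℕ k) index) ⟨
      (toℕ k + index) times g ∙ ι (f N.∙ b)              ≡⟨ cong (λ l → l times g ∙ ι (f N.∙ b)) eqn ⟨
      (toℕ (row x) + toℕ (row y)) times g ∙ ι (f N.∙ b)  ≡⟨ product x y ⟩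
      x ∙ y                                              ∎
      where
      gᵏ : Fin n
      gᵏ = toℕ k times g
      f b : Fin order
      f = twist (row y) (entry x)
      b = entry y

  -- Two of the powers g⁰, ..., gⁿ coincide in G, hence also modulo N; cancelling leaves a positive
  -- exponent.
  positive-power : ∀ g → ∃[ k ] suc k Q×.× g Q.≈ ε
  positive-power g with pigeonhole (n<1+n n) (λ i → toℕ i times g)
  ... | i , j , i<j , eqn with toℕ j ∸ toℕ i | m<n⇒0<n∸m i<j
      | times-cancel (quotient G N) g (<⇒≤ i<j)
          (Q.reflexive (trans (times-quotient (toℕ i) g) (trans eqn (sym (times-quotient (toℕ j) g)))))
  ...   | suc k | _ | eqn′ = k , eqn′

  coordinates : IsCyclic (quotient G N) → Coordinates G subgroup
  coordinates (g , generates) =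
    let k , gᵏ≈ε           = positive-power g
        -- Triviality modulo N is decided by searching N for a preimage under `ι`; the least
        -- exponent found, `suc m`, is the order of gN.
        m , gᵐ≈ε , minimal = least (λ j → any? (λ h → ι h ≟ _)) k gᵏ≈ε
    in coordinatesOfGenerator g generates m gᵐ≈ε minimal

-- Indexing into lists.

at-++ˡ : ∀ (xs {ys} : List A) i {x} → xs at i ≡ just x → (xs ++ ys) at i ≡ just x
at-++ˡ []       zero    ()
at-++ˡ []       (suc _) ()
at-++ˡ (x ∷ xs) zero    eqn = eqn
at-++ˡ (x ∷ xs) (suc i) eqn = at-++ˡ xs i eqn

at-++ʳ : ∀ (xs {ys} : List A) i → (xs ++ ys) at (i + length xs) ≡ ys at i
at-++ʳ []            i = cong (_ at_) (+-identityʳ i)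
at-++ʳ (x ∷ xs) {ys} i = trans (cong ((x ∷ xs ++ ys) at_) (+-suc i (length xs))) (at-++ʳ xs i)

at-map : ∀ (f : A → B) xs i {x} → xs at i ≡ just x → map f xs at i ≡ just (f x)
at-map f []       zero    ()
at-map f []       (suc _) ()
at-map f (x ∷ xs) zero    refl = refl
at-map f (x ∷ xs) (suc i) eqn  = at-map f xs i eqn

at-All : ∀ {P : A → Set} {xs x} i → All P xs → xs at i ≡ just x → P x
at-All zero    []         ()
at-All (suc _) []         ()
at-All zero    (px ∷ pxs) refl = px
at-All (suc i) (px ∷ pxs) eqn  = at-All i pxs eqn

at-tabulate : ∀ (f : Fin n → A) i → tabulate f at toℕ i ≡ just (f i)
at-tabulate f zero    = refl
at-tabulate f (suc i) = at-tabulate (f ∘ suc) i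

-- Values that fit in a word.

-- If the power were at most n, monotonicity of the logarithm would give 1 + ⌊log₂ n⌋ ≤ ⌊log₂ n⌋.
n<2^[1+⌊log₂n⌋] : ∀ n → n < 2 ^ (1 + ⌊log₂ n ⌋)
n<2^[1+⌊log₂n⌋] n = ≰⇒> λ 2ˡ≤n → 1+n≰n (begin
  1 + ⌊log₂ n ⌋               ≡⟨ ⌊log₂[2^n]⌋≡n (1 + ⌊log₂ n ⌋) ⟨
  ⌊log₂ 2 ^ (1 + ⌊log₂ n ⌋) ⌋ ≤⟨ ⌊log₂⌋-mono-≤ 2ˡ≤n ⟩
  ⌊log₂ n ⌋                   ∎)
  where open ≤-Reasoning

-- Since κ ≥ 1, a word is at least as long as the binary representation of n.
Word-≤-size : ∀ κ .{{_ : NonZero κ}} → v ≤ n → Word (wordLength κ n) v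
Word-≤-size {n = n} κ v≤n =
  ≤-<-trans v≤n (<-≤-trans (n<2^[1+⌊log₂n⌋] n) (^-monoʳ-≤ 2 (m≤n*m (1 + ⌊log₂ n ⌋) κ)))

-- Lets the words and the program of N be used on the machine for G, whose words are no shorter.
Word-mono : ∀ κ → m ≤ n → Word (wordLength κ m) v → Word (wordLength κ n) v
Word-mono κ m≤n v<2ʷ = <-≤-trans v<2ʷ (^-monoʳ-≤ 2 (*-monoʳ-≤ κ (s≤s (⌊log₂⌋-mono-≤ m≤n))))

-- Running a program inside a larger one.

-- A run never depends on a cell being empty, so it can be replayed with
-- more cells filled.

infix 4 _⊑_

_⊑_ : Cells → Cells → Set
ρ ⊑ σ = ∀ i {v} → ρ i ≡ just v → σ i ≡ just v

⊑-update : ∀ {ρ σ} i v → ρ ⊑ σ → ρ [ i ↦ v ] ⊑ σ [ i ↦ v ]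
⊑-update i v ρ⊑σ j with i ≡ᵇ j
... | true  = λ p → p
... | false = ρ⊑σ j

update-same : ∀ (ρ : Cells) i v → (ρ [ i ↦ v ]) i ≡ just v
update-same ρ i v with i ≡ᵇ i in eqn
... | true  = refl
... | false with () ← subst T eqn (≡⇒≡ᵇ i i refl)

update-other : ∀ (ρ : Cells) {i j} v → i < j → (ρ [ i ↦ v ]) j ≡ ρ j
update-other ρ {i} {j} v i<j with i ≡ᵇ j in eqn
... | true  = contradiction (≡ᵇ⇒≡ i j (subst T (sym eqn) _)) (<⇒≢ i<j)
... | false = refl

-- A query fills only registers 0 and 1, so the inner program may start among registers left over
-- from other computations.
query-⊑ : ∀ (ρ : Cells) {i j} → ρ 0 ≡ just i → ρ 1 ≡ just j →
          ((λ _ → nothing) [ 0 ↦ i ]) [ 1 ↦ j ] ⊑ ρ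
query-⊑ ρ p q 0 refl = p
query-⊑ ρ p q 1 refl = q
query-⊑ ρ p q (suc (suc _)) ()

-- Instructions that write no register get the default 0, which never raises the maximum from which
-- the kept register is chosen.
target : Instruction → ℕ
target (literal r _)     = r
target (copy r _)        = r
target (compute _ r _ _) = r
target (read r _ _)      = r
target (load r _)        = r
target _                 = 0

-- Only code addresses move: array numbers stay valid because new arrays are appended after the old
-- ones.
relocate : (offset exit : ℕ) → Instruction → Instruction
relocate o e (branch c r₁ r₂ l) = branch c r₁ r₂ (l + o)
relocate o e (jump l)           = jump (l + o)
relocate o e halt               = jump e
relocate o e i                  = i

module _ {w w′ : ℕ} {arrays extra : List (List ℕ)} {code code′ : List Instruction}
         (o e F : ℕ)
         (widen : ∀ {v} → Word w v → Word w′ v)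
         (embedded : ∀ p {i} → code at p ≡ just i → code′ at (p + o) ≡ just (relocate o e i))
         (fresh : ∀ p {i} → code at p ≡ just i → target i < F)
         where
  private
    module S = Execution w arrays code
    module T = Execution w′ (arrays ++ extra) code′

    kept-update : ∀ p {i k} ρ v → code at p ≡ just i → ρ F ≡ just k → (ρ [ target i ↦ v ]) F ≡ just k
    kept-update p ρ v instr kept = trans (update-other ρ v (fresh p instr)) kept

  -- By induction on the run, one instruction for one. The final `halt` becomes the jump to e, where
  -- `continue` takes over with the answer in register 0 and k intact in register F.
  simulate : ∀ p {t ρ μ ρ′ μ′ v k u t′} → S.Outputs t ⟨ p , ρ , μ ⟩ v →
             ρ ⊑ ρ′ → μ ⊑ μ′ → ρ′ F ≡ just k →
             (∀ {ρ″ μ″} → ρ″ 0 ≡ just v → ρ″ F ≡ just k → T.Outputs t′ ⟨ e , ρ″ , μ″ ⟩ u) →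
             T.Outputs (t + t′) ⟨ p + o , ρ′ , μ′ ⟩ u
  simulate p (S.stop instr r₀) ρ⊑ μ⊑ kept continue =
    T.step (T.jump (embedded p instr)) (continue (ρ⊑ 0 r₀) kept)
  simulate p {ρ′ = ρ′} (S.step (S.literal {r = r} {v} instr word) run) ρ⊑ μ⊑ kept continue =
    T.step (T.literal (embedded p instr) (widen word))
      (simulate _ run (⊑-update r v ρ⊑) μ⊑ (kept-update p ρ′ v instr kept) continue)
  simulate p {ρ′ = ρ′} (S.step (S.copy {r = r} {v = v} instr r₁) run) ρ⊑ μ⊑ kept continue =
    T.step (T.copy (embedded p instr) (ρ⊑ _ r₁))
      (simulate _ run (⊑-update r v ρ⊑) μ⊑ (kept-update p ρ′ v instr kept) continue)
  simulate p {ρ′ = ρ′} (S.step (S.compute {r = r} {v = v} instr r₁ r₂ result word) run) ρ⊑ μ⊑ kept continue =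
    T.step (T.compute (embedded p instr) (ρ⊑ _ r₁) (ρ⊑ _ r₂) result (widen word))
      (simulate _ run (⊑-update r v ρ⊑) μ⊑ (kept-update p ρ′ v instr kept) continue)
  simulate p {ρ′ = ρ′} (S.step (S.read {r = r} {A} {v = v} instr array r₁ cell) run) ρ⊑ μ⊑ kept continue =
    T.step (T.read (embedded p instr) (at-++ˡ arrays A array) (ρ⊑ _ r₁) cell)
      (simulate _ run (⊑-update r v ρ⊑) μ⊑ (kept-update p ρ′ v instr kept) continue)
  simulate p {ρ′ = ρ′} (S.step (S.load {r = r} {v = v} instr r₁ cell) run) ρ⊑ μ⊑ kept continue =
    T.step (T.load (embedded p instr) (ρ⊑ _ r₁) (μ⊑ _ cell))
      (simulate _ run (⊑-update r v ρ⊑) μ⊑ (kept-update p ρ′ v instr kept) continue)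
  simulate p (S.step (S.store {i = i} {v} instr r₁ r₂) run) ρ⊑ μ⊑ kept continue =
    T.step (T.store (embedded p instr) (ρ⊑ _ r₁) (ρ⊑ _ r₂))
      (simulate _ run ρ⊑ (⊑-update i v μ⊑) kept continue)
  simulate p {ρ′ = ρ′} {μ′} {u = u} (S.step (S.branch {c = c} {l = l} {v₁} {v₂} instr r₁ r₂) run) ρ⊑ μ⊑ kept continue =
    T.step (T.branch (embedded p instr) (ρ⊑ _ r₁) (ρ⊑ _ r₂))
      -- The induction hypothesis starts at the shifted conditional, whereas the relocated branch
      -- leads to a conditional of shifted labels.
      (subst (λ a → T.Outputs _ ⟨ a , ρ′ , μ′ ⟩ u) (if-float (_+ o) (evalComparison c v₁ v₂))
        (simulate _ run ρ⊑ μ⊑ kept continue))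
  simulate p (S.step (S.jump instr) run) ρ⊑ μ⊑ kept continue =
    T.step (T.jump (embedded p instr)) (simulate _ run ρ⊑ μ⊑ kept continue)

-- Tables addressed by elements and by pairs.

-- Elements are numbered from 1, so cell 0 is a dummy.

table : (Fin n → ℕ) → List ℕ
table f = 0 ∷ tabulate f

table-at : ∀ (f : Fin n → ℕ) i → table f at encode i ≡ just (f i)
table-at = at-tabulate

-- Row-major order: `remQuot` recovers the pair (i, a) from the position q i + a.
grid : (Fin m → Fin q → Fin l) → List ℕ
grid {m} {q} f = table (λ p → encode (uncurry f (remQuot {m} q p)))

-- The 1 in `encode a` also skips the dummy cell, so a single addition yields the address.
encode-combine : ∀ (i : Fin m) (a : Fin q) → encode a + toℕ i * q ≡ encode (combine i a)
encode-combine {q = q} i a = cong suc (begin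
  toℕ a + toℕ i * q  ≡⟨ +-comm (toℕ a) (toℕ i * q) ⟩
  toℕ i * q + toℕ a  ≡⟨ cong (_+ toℕ a) (*-comm (toℕ i) q) ⟩
  q * toℕ i + toℕ a  ≡⟨ toℕ-combine i a ⟨
  toℕ (combine i a)  ∎)
  where open ≡-Reasoning

grid-at : ∀ (f : Fin m → Fin q → Fin l) i a → grid f at (encode a + toℕ i * q) ≡ just (encode (f i a))
grid-at {m} {q} f i a = begin
  grid f at (encode a + toℕ i * q)                     ≡⟨ cong (grid f at_) (encode-combine i a) ⟩
  grid f at encode (combine i a)                       ≡⟨ table-at _ (combine i a) ⟩
  just (encode (uncurry f (remQuot q (combine i a))))  ≡⟨ cong (λ p → just (encode (uncurry f p))) (remQuot-combine i a) ⟩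
  just (encode (f i a))                                ∎
  where open ≡-Reasoning

-- Adding row numbers modulo m.

-- Comparing i with m − j instead of i + j with m keeps every intermediate
-- value at most m q, hence in a word.

data RowSum (m q : ℕ) (i j : Fin m) : Set where
  small : ∀ (k : Fin m) → toℕ i + toℕ j ≡ toℕ k →
          (toℕ i * q <ᵇ m * q ∸ toℕ j * q) ≡ true → toℕ i * q + toℕ j * q ≡ toℕ k * q →
          RowSum m q i j
  large : ∀ (k : Fin m) → toℕ i + toℕ j ≡ toℕ k + m →
          (toℕ i * q <ᵇ m * q ∸ toℕ j * q) ≡ false → toℕ i * q ∸ (m * q ∸ toℕ j * q) ≡ toℕ k * q →
          RowSum m q i j

-- The nonzero factor q cancels: the scaled test decides i < m - j, that is, i + j < m.
rowSum : ∀ (i j : Fin m) → .{{NonZero q}} → RowSum m q i j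
rowSum {m} {q} i j with toℕ i * q <ᵇ m * q ∸ toℕ j * q in eqn
... | true = small (fromℕ< i+j<m) (sym (toℕ-fromℕ< i+j<m)) eqn
    (trans (sym (*-distribʳ-+ q (toℕ i) (toℕ j))) (cong (_* q) (sym (toℕ-fromℕ< i+j<m))))
  where
  i<m∸j : toℕ i < m ∸ toℕ j
  i<m∸j = *-cancelʳ-< q (toℕ i) (m ∸ toℕ j)
    (subst (toℕ i * q <_) (sym (*-distribʳ-∸ q m (toℕ j))) (<ᵇ⇒< _ _ (Equivalence.from T-≡ eqn)))
  i+j<m : toℕ i + toℕ j < m
  i+j<m = subst (toℕ i + toℕ j <_) (m∸n+n≡m (<⇒≤ (toℕ<n j))) (+-monoˡ-< (toℕ j) i<m∸j)
... | false = large (fromℕ< k<m) i+j≡k+m eqn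
    (trans (cong (toℕ i * q ∸_) (sym (*-distribʳ-∸ q m (toℕ j))))
      (trans (sym (*-distribʳ-∸ q (toℕ i) (m ∸ toℕ j))) (cong (_* q) (sym (toℕ-fromℕ< k<m)))))
  where
  m∸j≤i : m ∸ toℕ j ≤ toℕ i
  m∸j≤i = *-cancelʳ-≤ (m ∸ toℕ j) (toℕ i) q
    (subst (_≤ toℕ i * q) (sym (*-distribʳ-∸ q m (toℕ j)))
      (≮⇒≥ λ lt → subst T eqn (<⇒<ᵇ lt)))
  -- This is i + j - m, the reduced exponent.
  k : ℕ
  k = toℕ i ∸ (m ∸ toℕ j)
  k<m : k < m
  k<m = ≤-<-trans (m∸n≤m (toℕ i) (m ∸ toℕ j)) (toℕ<n i)
  i+j≡k+m : toℕ i + toℕ j ≡ toℕ (fromℕ< k<m) + m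
  i+j≡k+m = begin
    toℕ i + toℕ j                    ≡⟨ cong (_+ toℕ j) (m∸n+n≡m m∸j≤i) ⟨
    k + (m ∸ toℕ j) + toℕ j          ≡⟨ +-assoc k (m ∸ toℕ j) (toℕ j) ⟩
    k + (m ∸ toℕ j + toℕ j)          ≡⟨ cong₂ _+_ (sym (toℕ-fromℕ< k<m)) (m∸n+n≡m (<⇒≤ (toℕ<n j))) ⟩
    toℕ (fromℕ< k<m) + m             ∎
    where open ≡-Reasoning

-- The extended data structure.

module _ {G : FiniteGroup n} {H : FiniteGroup q} (coords : Coordinates G H)
         (κ : ℕ) .{{_ : NonZero κ}} (q≤n : q ≤ n) (D : DataStructure (wordLength κ q))
         where
  private
    module G = FiniteGroup G
    module H = FiniteGroup H
    module D = DataStructure D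
    open Coordinates coords

    instance
      q≢0 : NonZero q
      q≢0 = nonZeroIndex H.ε

    w : ℕ
    w = wordLength κ n

    size : ℕ
    size = index * q

    -- `join` embeds the pairs (i, a) into G. This bounds the size of every grid and every scaled
    -- row by n.
    size≤n : size ≤ n
    size≤n = injective⇒≤ {f = λ p → uncurry join (remQuot {index} q p)} injective
      where
      injective : ∀ {p p′ : Fin size} → uncurry join (remQuot {index} q p) ≡ uncurry join (remQuot {index} q p′) → p ≡ p′
      injective {p} {p′} eqn with join-injective eqn
      ... | i≡j , a≡b = trans (sym (combine-remQuot {index} q p))
        (trans (cong₂ combine i≡j a≡b) (combine-remQuot {index} q p′))

    rows entries twists carryTwists joins : List ℕ
    -- Rows are stored multiplied by q, so that adding an encoded entry gives a grid address at
    -- once.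
    rows        = table (λ x → toℕ (row x) * q)
    entries     = table (λ x → encode (entry x))
    twists      = grid twist
    carryTwists = grid carryTwist
    joins       = grid join

    tables : List (List ℕ)
    tables = rows ∷ entries ∷ twists ∷ carryTwists ∷ joins ∷ []

    rows# entries# twists# carryTwists# joins# : ArrayName
    rows#        = 0 + length D.arrays
    entries#     = 1 + length D.arrays
    twists#      = 2 + length D.arrays
    carryTwists# = 3 + length D.arrays
    joins#       = 4 + length D.arrays

    -- Keeps the row of the product during the inner query.
    kept : Register
    kept = 5 + max 0 (map target D.code)

    -- 13 is the length of the prologue.
    exit : Label
    exit = length D.code + 13

    -- The prologue leaves the two factors of the inner query in registers 0 and 1 and the scaled
    -- row of the product in `kept`. The epilogue adds that row to the inner answer to address
    -- `joins`.
    prologue body epilogue code : List Instruction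
    prologue =
        read 2 rows# 0
      ∷ read 3 rows# 1
      ∷ read 4 entries# 0
      ∷ read 1 entries# 1
      ∷ compute add 4 4 3
      ∷ literal 5 size
      ∷ compute sub 5 5 3
      -- Compares i q with (m - j) q; label 11 is the case without carry.
      ∷ branch lt 2 5 11
      ∷ read 0 carryTwists# 4
      -- `kept` may be register 5 itself, whose old value is read before being overwritten.
      ∷ compute sub kept 2 5
      ∷ jump 13
      ∷ read 0 twists# 4
      ∷ compute add kept 2 3
      ∷ []
    body = map (relocate 13 exit) D.code
    epilogue =
        compute add 0 0 kept
      ∷ read 0 joins# 0
      ∷ halt
      ∷ []
    code = prologue ++ body ++ epilogue

    words : All (All (Word w)) (D.arrays ++ tables)
    words = All.++⁺ (All.map (All.map (Word-mono {n = n} κ q≤n)) D.words)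
      ( table-words (λ x → ≤-trans (*-monoˡ-≤ q (<⇒≤ (toℕ<n (row x)))) size≤n)
      ∷ table-words (λ x → ≤-trans (toℕ<n (entry x)) q≤n)
      ∷ table-words (λ p → ≤-trans (toℕ<n (uncurry twist (remQuot {index} q p))) q≤n)
      ∷ table-words (λ p → ≤-trans (toℕ<n (uncurry carryTwist (remQuot {index} q p))) q≤n)
      ∷ table-words (λ p → toℕ<n (uncurry join (remQuot {index} q p)))
      ∷ [])
      where
      table-words : ∀ {f : Fin m → ℕ} → (∀ i → f i ≤ n) → All (Word w) (table f)
      table-words f≤n = Word-≤-size {n = n} κ z≤n ∷ All.tabulate⁺ (λ i → Word-≤-size {n = n} κ (f≤n i))

  extension : DataStructure w
  extension = record { arrays = D.arrays ++ tables ; words = words ; code = code }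

  private
    module E = DataStructure extension

    at-tables : ∀ i → E.arrays at (i + length D.arrays) ≡ tables at i
    at-tables = at-++ʳ D.arrays

    at-body : ∀ p {i} → D.code at p ≡ just i → code at (p + 13) ≡ just (relocate 13 exit i)
    at-body p eqn = trans (at-++ʳ prologue p) (at-++ˡ body p (at-map (relocate 13 exit) D.code p eqn))

    at-epilogue : ∀ i → code at (i + exit) ≡ epilogue at i
    at-epilogue i = begin
      code at (i + exit)                             ≡⟨ cong (code at_) (+-assoc i (length D.code) 13) ⟨
      code at (i + length D.code + 13)               ≡⟨ at-++ʳ prologue (i + length D.code) ⟩
      (body ++ epilogue) at (i + length D.code)      ≡⟨ cong (λ k → (body ++ epilogue) at (i + k)) (length-map _ D.code) ⟨
      (body ++ epilogue) at (i + length body)        ≡⟨ at-++ʳ body i ⟩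
      epilogue at i                                  ∎
      where open ≡-Reasoning

    fresh : ∀ p {i} → D.code at p ≡ just i → target i < kept
    fresh p eqn = s≤s (≤-trans (at-All p (xs≤max 0 (map target D.code)) (at-map target D.code p eqn)) (m≤n+m _ 4))

    row-word : ∀ (k : Fin index) {v} → v ≡ toℕ k * q → Word w v
    row-word k refl = Word-≤-size κ (≤-trans (*-monoˡ-≤ q (<⇒≤ (toℕ<n k))) size≤n)

    cell-word : ∀ (i : Fin index) (a : Fin q) → Word w (encode a + toℕ i * q)
    cell-word i a = Word-≤-size κ (subst (_≤ n) (sym (encode-combine i a)) (≤-trans (toℕ<n (combine i a)) size≤n))

    -- Correctness and query time.

    run-inner : ∀ {t ρ μ a b} k → D.Outputs t (query a b) (encode (a H.∙ b)) →
                ρ 0 ≡ just (encode a) → ρ 1 ≡ just (encode b) → ρ kept ≡ just (toℕ k * q) →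
                E.Outputs (t + 3) ⟨ 13 , ρ , μ ⟩ (encode (join k (a H.∙ b)))
    run-inner {ρ = ρ} {a = a} {b} k run r₀ r₁ rₖ =
      -- The inner query expects an empty scratch memory, which any contents extend.
      simulate 13 exit kept (Word-mono {n = n} κ q≤n) at-body fresh 0 run (query-⊑ ρ r₀ r₁) (λ _ ()) rₖ λ r₀ rₖ →
          E.step (E.compute (at-epilogue 0) r₀ rₖ refl (cell-word k (a H.∙ b)))
            (E.step (E.read (at-epilogue 1) (at-tables 4) refl (grid-at join k (a H.∙ b)))
              (E.stop (at-epilogue 2) refl))

    Answers : ℕ → Set
    Answers t = ∀ a b → ∃[ t′ ] t′ ≤ t × D.Outputs t′ (query a b) (encode (a H.∙ b))

    -- The eight instructions up to the branch are shared by both cases. `continue` is given the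
    -- contents of five registers and nothing else about ρ and μ.
    start : ∀ {t v} x y → (∀ {ρ μ} →
              ρ 1 ≡ just (encode (entry y)) → ρ 2 ≡ just (toℕ (row x) * q) → ρ 3 ≡ just (toℕ (row y) * q) →
              ρ 4 ≡ just (encode (entry x) + toℕ (row y) * q) → ρ 5 ≡ just (size ∸ toℕ (row y) * q) →
              E.Outputs t ⟨ if toℕ (row x) * q <ᵇ size ∸ toℕ (row y) * q then 11 else 8 , ρ , μ ⟩ v) →
            E.Outputs (8 + t) (query x y) v
    start x y continue =
      E.step (E.read refl (at-tables 0) refl (table-at _ x)) (
      E.step (E.read refl (at-tables 0) refl (table-at _ y)) (
      E.step (E.read refl (at-tables 1) refl (table-at _ x)) (
      E.step (E.read refl (at-tables 1) refl (table-at _ y)) (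
      E.step (E.compute refl refl refl refl (cell-word (row y) (entry x))) (
      E.step (E.literal refl (Word-≤-size κ size≤n)) (
      E.step (E.compute refl refl refl refl (Word-≤-size κ (≤-trans (m∸n≤m size (toℕ (row y) * q)) size≤n))) (
      E.step (E.branch refl refl refl)
        (continue refl refl refl refl refl))))))))

  extension-answers : ∀ {t} → Answers t → ∀ x y →
                      ∃[ t′ ] t′ ≤ 11 + (t + 3) × E.Outputs t′ (query x y) (encode (x G.∙ y))
  extension-answers {t} answers x y with rowSum {q = q} (row x) (row y)
  ... | small k i+j≡k below sum≡ with answers (twist (row y) (entry x)) (entry y)
  ...   | t′ , t′≤t , run = 8 + (2 + (t′ + 3)) , bound ,
      start x y λ {ρ} {μ} r₁ r₂ r₃ r₄ r₅ →
        subst₂ (λ b z → E.Outputs (2 + (t′ + 3)) ⟨ if b then 11 else 8 , ρ , μ ⟩ (encode z)) (sym below) (∙-join x y k i+j≡k)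
          (E.step (E.read refl (at-tables 2) r₄ (grid-at twist (row y) (entry x)))
          (E.step (E.compute refl r₂ r₃ refl (row-word k sum≡))
          (run-inner k run refl r₁ (trans (update-same (ρ [ 0 ↦ encode (twist (row y) (entry x)) ]) kept _) (cong just sum≡)))))
    where
    bound : 8 + (2 + (t′ + 3)) ≤ 11 + (t + 3)
    -- Without carry there is no jump, so this case takes one step less than the bound allows.
    bound = m≤n⇒m≤1+n (+-monoʳ-≤ 10 (+-monoˡ-≤ 3 t′≤t))
  extension-answers {t} answers x y | large k i+j≡k+m notBelow diff≡ with answers (carryTwist (row y) (entry x)) (entry y)
  ...   | t′ , t′≤t , run = 8 + (3 + (t′ + 3)) , bound ,
      start x y λ {ρ} {μ} r₁ r₂ r₃ r₄ r₅ →
        subst₂ (λ b z → E.Outputs (3 + (t′ + 3)) ⟨ if b then 11 else 8 , ρ , μ ⟩ (encode z)) (sym notBelow) (∙-join-carry x y k i+j≡k+m)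
          (E.step (E.read refl (at-tables 3) r₄ (grid-at carryTwist (row y) (entry x)))
          (E.step (E.compute refl r₂ r₅ refl (row-word k diff≡))
          (E.step (E.jump refl)
          (run-inner k run refl r₁ (trans (update-same (ρ [ 0 ↦ encode (carryTwist (row y) (entry x)) ]) kept _) (cong just diff≡))))))
    where
    bound : 8 + (3 + (t′ + 3)) ≤ 11 + (t + 3)
    bound = +-monoʳ-≤ 11 (+-monoˡ-≤ 3 t′≤t)

  -- Space and the constants.

  -- The additions are 13 + 3 instructions and five tables of at most n + 1 cells: 16 + 5(n + 1) =
  -- 21 + 5n ≤ 26n, as n ≥ 1.
  extension-space : E.space ≤ D.space + 26 * n
  extension-space = begin
    sum (map length (D.arrays ++ tables)) + length code
      ≡⟨ cong₂ _+_ (trans (cong sum (map-++ length D.arrays tables)) (sum-++ (map length D.arrays) _))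
                   (cong (13 +_) (trans (length-++ body) (cong (_+ 3) (length-map _ D.code)))) ⟩
    a + sum (map length tables) + (13 + (b + 3))
      ≤⟨ +-monoˡ-≤ (13 + (b + 3)) (+-monoʳ-≤ a tables-length) ⟩
    a + 5 * suc n + (13 + (b + 3))
      ≡⟨ solve 3 (λ a b n → a :+ con 5 :* (con 1 :+ n) :+ (con 13 :+ (b :+ con 3))
                         := (a :+ b) :+ (con 21 :+ con 5 :* n)) refl a b n ⟩
    (a + b) + (21 + 5 * n)
      ≤⟨ +-monoʳ-≤ (a + b) (+-monoˡ-≤ (5 * n) (*-monoʳ-≤ 21 0<n)) ⟩
    (a + b) + (21 * n + 5 * n)
      ≡⟨ cong ((a + b) +_) (*-distribʳ-+ n 21 5) ⟨
    (a + b) + 26 * n ∎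
    where
    open ≤-Reasoning
    open +-*-Solver
    a b : ℕ
    a = sum (map length D.arrays)
    b = length D.code
    0<n : 0 < n
    0<n = ≤-trans (s≤s z≤n) (toℕ<n G.ε)
    short : ∀ {f : Fin m → ℕ} → m ≤ n → length (table f) ≤ suc n
    short {f = f} m≤n = s≤s (subst (_≤ n) (sym (length-tabulate f)) m≤n)
    tables-length : sum (map length tables) ≤ 5 * suc n
    tables-length =
      +-mono-≤ (short ≤-refl) (+-mono-≤ (short ≤-refl)
      (+-mono-≤ (short size≤n) (+-mono-≤ (short size≤n) (+-mono-≤ (short size≤n) z≤n))))

theorem4 : (κ : ℕ) .{{_ : NonZero κ}} →
    ∃₂ λ (c d : ℕ) → 0 < c × 0 < d ×
    (∀ {n : ℕ} (G : FiniteGroup n) (N : NormalSubgroup G) →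
    IsCyclic (quotient G N) →
    ∀ (s t : ℕ) →
    HasDataStructure κ (NormalSubgroup.subgroup N) s t →
    HasDataStructure κ G (s + c * n) (2 * t + d))
-- 26 bounds the added words per element of G; 14 counts at most 11 steps of the prologue and 3 of
-- the epilogue.
theorem4 κ = 26 , 14 , z<s , z<s , λ {n} G N cyclic s t (D , space≤s , answers) →
  let module N = NormalSubgroup N
      coords   = coordinates G N cyclic
      order≤n  = injective⇒≤ N.injective
      answers′ = extension-answers coords κ order≤n D answers
  in extension coords κ order≤n D ,
     ≤-trans (extension-space coords κ order≤n D) (+-monoˡ-≤ (26 * n) space≤s) ,
     λ x y → let t′ , t′≤ , run = answers′ x y in t′ , ≤-trans t′≤ (time-bound t) , run
  where
  time-bound : ∀ t → 11 + (t + 3) ≤ 2 * t + 14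
  time-bound t = begin
    11 + (t + 3)  ≡⟨ solve 1 (λ t → con 11 :+ (t :+ con 3) := t :+ con 14) refl t ⟩
    t + 14        ≤⟨ +-monoˡ-≤ 14 (m≤n*m t 2) ⟩
    2 * t + 14    ∎
    where
    open ≤-Reasoning
    open +-*-Solver
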